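{- For each of the following pairs $(p,\beta)$, there exists no infinite word over the ternary alphabet $\{0,1,2\}$ that is $\beta$-free and contains at most $p$ distinct palindromes (the empty word being counted as a palindrome): (a) $(p,\beta)=(4,\beta)$ for any fixed real $\beta\ge 1$; (b) $(p,\beta)=(5,\tfrac{10}{3})$; (c) $(p,\beta)=(15,2)$; (d) $(p,\beta)=(17,\tfrac{41}{22})$.
   Context: An infinite word is a right-infinite sequence of letters. For a nonempty finite word $u$ and a rational $r>1$, a word $v$ is an $r$-power (of $u$) if $v$ is a prefix of the infinite periodic word $uuu\cdots$ and $|v|/|u|=r$. A word is $\beta$-free if none of its factors (contiguous blocks) is an $r$-power with $r\ge\beta$. A palindrome is a finite word equal to its reversal; a word contains a palindrome if the palindrome is one of its factors. The number of palindromes always refers to the number of distinct palindromes, including the empty word. -}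

module Defs where

open import Data.Integer.Base using (+_)
open import Data.List.Base using (List; length; lookup; reverse; applyUpTo)
open import Data.List.NonEmpty.Base as List⁺ using (List⁺)
open import Data.List.Relation.Unary.All using (All)
open import Data.List.Relation.Unary.Unique.Propositional using (Unique)
open import Data.Nat.Base as ℕ using (ℕ)
open import Data.Nat.DivMod using (_mod_)
open import Data.Product.Base using (∃; ∃-syntax; _×_; _,_)
open import Data.Rational.Base as ℚ using (ℚ; 1ℚ)
import Data.Rational.Properties as ℚ
open import Data.Sum.Base using (_⊎_; inj₁; inj₂)
open import Relation.Binary.PropositionalEquality using (_≡_; subst)
open import Relation.Nullary.Decidable using (yes; no)
open import Relation.Nullary.Negation using (¬_)

-- Real numbers as (two-sided) Dedekind cuts: L q means q < x, U q means x < q.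
record ℝ : Set₁ where
  field
    L U       : ℚ → Set
    L-inhab   : ∃ L
    U-inhab   : ∃ U
    L-lower   : ∀ {q r} → q ℚ.< r → L r → L q
    U-upper   : ∀ {q r} → q ℚ.< r → U q → U r
    L-rounded : ∀ {q} → L q → ∃[ r ] q ℚ.< r × L r
    U-rounded : ∀ {r} → U r → ∃[ q ] q ℚ.< r × U q
    disjoint  : ∀ {q} → L q → ¬ U q
    located   : ∀ {q r} → q ℚ.< r → L q ⊎ U r

open ℝ

infix 4 _≤_

_≤_ : ℝ → ℝ → Set
x ≤ y = ∀ {q} → L x q → L y q

private
  <-suc : ∀ q → q ℚ.< q ℚ.+ 1ℚ
  <-suc q = subst (ℚ._< q ℚ.+ 1ℚ) (ℚ.+-identityʳ q)
              (ℚ.+-monoʳ-< q (ℚ.positive⁻¹ 1ℚ))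

  pred-< : ∀ q → q ℚ.+ (ℚ.- 1ℚ) ℚ.< q
  pred-< q = subst (q ℚ.+ (ℚ.- 1ℚ) ℚ.<_) (ℚ.+-identityʳ q)
               (ℚ.+-monoʳ-< q (ℚ.negative⁻¹ (ℚ.- 1ℚ)))

  cut-located : ∀ p {q r} → q ℚ.< r → q ℚ.< p ⊎ p ℚ.< r
  cut-located p {q} q<r with q ℚ.<? p
  ... | yes q<p = inj₁ q<p
  ... | no  q≮p = inj₂ (ℚ.≤-<-trans (ℚ.≮⇒≥ q≮p) q<r)

fromℚ : ℚ → ℝ
fromℚ p = record
  { L         = ℚ._< p
  ; U         = p ℚ.<_
  ; L-inhab   = _ , pred-< p
  ; U-inhab   = _ , <-suc p
  ; L-lower   = ℚ.<-trans
  ; U-upper   = λ q<r p<q → ℚ.<-trans p<q q<r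
  ; L-rounded = ℚ.<-dense
  ; U-rounded = λ p<r → let q , p<q , q<r = ℚ.<-dense p<r in q , q<r , p<q
  ; disjoint  = ℚ.<-asym
  ; located   = cut-located p
  }

module _ {A : Set} where

  _IsFactorOf_ : List A → (ℕ → A) → Set
  v IsFactorOf w = ∃[ i ] v ≡ applyUpTo (λ k → w (i ℕ.+ k)) (length v)

  -- The periodic word u u u ⋯
  _^ω : List⁺ A → ℕ → A
  (u ^ω) k = lookup (List⁺.toList u) (k mod List⁺.length u)

  _Is_-PowerOf_ : List A → ℚ → List⁺ A → Set
  v Is r -PowerOf u =
    1ℚ ℚ.< r ×
    v ≡ applyUpTo (u ^ω) (length v) ×
    + length v ℚ./ List⁺.length u ≡ r

  _Is_-Free : (ℕ → A) → ℝ → Set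
  w Is β -Free =
    ∀ {v r u} → v IsFactorOf w → v Is r -PowerOf u → ¬ (β ≤ fromℚ r)

  Palindrome : List A → Set
  Palindrome v = v ≡ reverse v

  _ContainsAtMost_Palindromes : (ℕ → A) → ℕ → Set
  w ContainsAtMost p Palindromes =
    ∀ vs → Unique vs → All (λ v → Palindrome v × v IsFactorOf w) vs →
    length vs ℕ.≤ p

{-# OPTIONS --safe #-}

-- A finite search refutes each bound. Suppose w is free of certain repetitions
-- and has few palindromes, and let v be a finite word. Either v occurs in w, and
-- then w contains an infinite word starting with v, or v is avoided by w. Splitting
-- in this way on a few short palindromes leaves cases in which extending a prefix
-- letter by letter soon runs into a repetition, an avoided word or one palindrome
-- too many. For p = 4 the search only shows w (3 + i) ≡ w i, and such a word
-- contains arbitrarily high powers.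
module Submission where

open import Defs
open import Data.Bool.Base using (Bool; true; false; T; not; _∧_; _∨_; if_then_else_)
open import Data.Bool.ListAction using (any; all)
open import Data.Bool.Properties as Bool using (T-∧; T-∨; T-≡)
open import Data.Empty using (⊥-elim)
open import Data.Fin.Base using (Fin; toℕ)
open import Data.Fin.Patterns using (0F; 1F; 2F)
import Data.Fin.Properties as Fin
open import Data.Integer.Base as ℤ using (+_; ∣_∣)
import Data.Integer.Properties as ℤ
open import Data.List.Base
  using (List; []; _∷_; length; map; take; drop; foldr; reverse;
         allFin; applyUpTo; applyDownFrom)
open import Data.List.Membership.Propositional.Properties using (∈-allFin)
open import Data.List.NonEmpty.Base as List⁺ using (List⁺; _∷_)
open import Data.List.Properties
  using (≡-dec; length-applyUpTo; length-applyDownFrom; lookup-applyUpTo;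
         reverse-applyDownFrom)
open import Data.List.Relation.Unary.All as All using (All; []; _∷_)
open import Data.List.Relation.Unary.All.Properties using (¬Any⇒All¬; all⁺)
open import Data.List.Relation.Unary.AllPairs.Core using ([]; _∷_)
open import Data.List.Relation.Unary.Any.Properties using (any⁻)
open import Data.List.Relation.Unary.Unique.Propositional using (Unique)
open import Data.Nat.Base as ℕ using (ℕ; zero; suc; _+_; _*_; _∸_; _<_; _<ᵇ_; s≤s; z<s)
open import Data.Nat.DivMod using (_mod_; _%_; m≡m%n+[m/n]*n; m%n<n; %-congʳ)
import Data.Nat.Properties as ℕ
open import Data.Product.Base using (∃; ∃₂; _×_; _,_; proj₁; proj₂)
open import Data.Rational.Base as ℚ using (ℚ; 1ℚ; _/_)
import Data.Rational.Properties as ℚ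
import Data.Rational.Unnormalised.Base as ℚᵘ
import Data.Rational.Unnormalised.Properties as ℚᵘ
open import Data.Sum.Base using (_⊎_; inj₁; inj₂; [_,_]′)
open import Function.Base using (_∘_; _$_; case_of_)
open import Function.Bundles using (module Equivalence)
open import Relation.Binary.Definitions using (DecidableEquality; tri<; tri≈; tri>)
open import Relation.Binary.PropositionalEquality
open import Relation.Nullary.Decidable using (Dec; _⊎-dec_; does; yes; no)
open import Relation.Nullary.Negation using (¬_)

open Equivalence using (to; from)
open ℝ using (U; U-inhab; U-upper; disjoint)

-- Repetitions

fromℚ-mono-≤ : ∀ {p q} → p ℚ.≤ q → fromℚ p ≤ fromℚ q
fromℚ-mono-≤ p≤q s<p = ℚ.<-≤-trans s<p p≤q

-- The order compares lower cuts, and a rational of the lower cut at or above `p` would also lie in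
-- the upper cut.
U⇒≤fromℚ : ∀ β {p} → U β p → β ≤ fromℚ p
U⇒≤fromℚ β {p} p∈U {s} s∈L with ℚ.<-cmp s p
... | tri< s<p _ _    = s<p
... | tri≈ _ refl _   = ⊥-elim (disjoint β s∈L p∈U)
... | tri> _ _ p<s    = ⊥-elim (disjoint β s∈L (U-upper β p<s p∈U))

-- `_/_` reduces to lowest terms; on unnormalised rationals the cross-multiplied inequality applies
-- as it stands.
/-mono : ∀ {a b c d} → a ℤ.* + suc d ℤ.≤ b ℤ.* + suc c → a / suc c ℚ.≤ b / suc d
/-mono {a} {b} {c} {d} ad≤bc = ℚ.toℚᵘ-cancel-≤ (begin
  ℚ.toℚᵘ (a / suc c)  ≃⟨ ℚ.toℚᵘ-fromℚᵘ (ℚᵘ.mkℚᵘ a c) ⟩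
  ℚᵘ.mkℚᵘ a c         ≤⟨ ℚᵘ.*≤* ad≤bc ⟩
  ℚᵘ.mkℚᵘ b d         ≃⟨ ℚ.toℚᵘ-fromℚᵘ (ℚᵘ.mkℚᵘ b d) ⟨
  ℚ.toℚᵘ (b / suc d)  ∎)
  where open ℚᵘ.≤-Reasoning

/-mono-< : ∀ {a b c d} → a ℤ.* + suc d ℤ.< b ℤ.* + suc c → a / suc c ℚ.< b / suc d
/-mono-< {a} {b} {c} {d} ad<bc = ℚ.toℚᵘ-cancel-< (begin-strict
  ℚ.toℚᵘ (a / suc c)  ≃⟨ ℚ.toℚᵘ-fromℚᵘ (ℚᵘ.mkℚᵘ a c) ⟩
  ℚᵘ.mkℚᵘ a c         <⟨ ℚᵘ.*<* ad<bc ⟩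
  ℚᵘ.mkℚᵘ b d         ≃⟨ ℚ.toℚᵘ-fromℚᵘ (ℚᵘ.mkℚᵘ b d) ⟨
  ℚ.toℚᵘ (b / suc d)  ∎)
  where open ℚᵘ.≤-Reasoning

applyUpTo-cong : ∀ {A : Set} {f g : ℕ → A} n → (∀ {k} → k < n → f k ≡ g k) →
                 applyUpTo f n ≡ applyUpTo g n
applyUpTo-cong zero    f≗g = refl
applyUpTo-cong (suc n) f≗g = cong₂ _∷_ (f≗g z<s) (applyUpTo-cong n (f≗g ∘ s≤s))

-- Both concern a factor of period suc q and length suc q + suc m, starting at position j.
exponent : ℕ → ℕ → ℚ
exponent q m = + (suc q + suc m) / suc q

RepeatsAt : ∀ {A : Set} → (ℕ → A) → ℕ → ℕ → ℕ → Set
RepeatsAt w j q m = ∀ {k} → k < suc m → w (j + (k + suc q)) ≡ w (j + k)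

1<exponent : ∀ q m → 1ℚ ℚ.< exponent q m
1<exponent q m = /-mono-< {+ 1} {+ (suc q + suc m)} {0} {q} (ℤ.+<+ (begin-strict
  1 * suc q              ≡⟨ ℕ.*-identityˡ (suc q) ⟩
  suc q                  <⟨ ℕ.m<m+n (suc q) z<s ⟩
  suc q + suc m          ≡⟨ ℕ.*-identityʳ _ ⟨
  (suc q + suc m) * 1    ∎))
  where open ℕ.≤-Reasoning

module _ {A : Set} (w : ℕ → A) {j q m} (rep : RepeatsAt w j q m) where

  private
    Q L : ℕ
    Q = suc q
    L = suc q + suc m

    f : ℕ → A
    f k = w (j + k)

    u : List⁺ A
    u = f 0 ∷ applyUpTo (f ∘ suc) q

    length-u : List⁺.length u ≡ Q
    length-u = length-applyUpTo f Q

    reduce-* : ∀ t r → r + t * Q < L → f (r + t * Q) ≡ f r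
    reduce-* zero    r lt = cong f (ℕ.+-identityʳ r)
    reduce-* (suc t) r lt = begin
      f (r + (Q + t * Q))  ≡⟨ cong f shift ⟩
      -- `rep` needs `r + t * Q < suc m`: the bound by `L` with one period cancelled.
      f (r + t * Q + Q)    ≡⟨ rep (ℕ.+-cancelʳ-< Q _ _ lt′) ⟩
      f (r + t * Q)        ≡⟨ reduce-* t r (ℕ.≤-<-trans (ℕ.m≤m+n _ Q) (subst (_< L) shift lt)) ⟩
      f r                  ∎
      where
      open ≡-Reasoning
      shift : r + (Q + t * Q) ≡ r + t * Q + Q
      shift = trans (cong (_+_ r) (ℕ.+-comm Q (t * Q))) (sym (ℕ.+-assoc r (t * Q) Q))
      lt′ : r + t * Q + Q < suc m + Q
      lt′ = subst₂ _<_ shift (ℕ.+-comm Q (suc m)) lt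

    reduce-% : ∀ {k} → k < L → f k ≡ f (k % Q)
    reduce-% {k} k<L = trans (cong f k≡) (reduce-* (k ℕ./ Q) (k % Q) (subst (_< L) k≡ k<L))
      where k≡ = m≡m%n+[m/n]*n k Q

    f≗u^ω : ∀ {k} → k < L → f k ≡ (u ^ω) k
    f≗u^ω {k} k<L = begin
      f k                           ≡⟨ reduce-% k<L ⟩
      f (k % Q)                     ≡⟨ cong f (%-congʳ {o = k} length-u) ⟨
      f (k % List⁺.length u)        ≡⟨ cong f (Fin.toℕ-fromℕ< (m%n<n k (List⁺.length u))) ⟨
      f (toℕ (k mod List⁺.length u)) ≡⟨ lookup-applyUpTo f Q (k mod List⁺.length u) ⟨
      (u ^ω) k                      ∎
      where open ≡-Reasoning

    v : List A
    v = applyUpTo f L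

    length-v : length v ≡ L
    length-v = length-applyUpTo f L

    /-cong-suc : ∀ {a b c d} → a ≡ b → c ≡ d → + a / suc c ≡ + b / suc d
    /-cong-suc refl refl = refl

  -- The root is the block of the first `Q` letters: going back one period at a time takes each
  -- index below `L` to its residue modulo `Q`.
  repeat⇒¬free : ∀ {β} → β ≤ fromℚ (exponent q m) → ¬ (w Is β -Free)
  repeat⇒¬free β≤r free = free {v} {exponent q m} {u}
    (j , cong (applyUpTo f) (sym length-v))
    ( 1<exponent q m
    , trans (applyUpTo-cong L f≗u^ω) (cong (applyUpTo (u ^ω)) (sym length-v))
    , /-cong-suc length-v (ℕ.suc-injective length-u)
    )
    β≤r

-- For a rational `p` above `β` with numerator of absolute value `n`, the choice `m = n * suc q`
-- makes the exponent exceed `n`, which is at least `p`.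
exponent-unbounded : ∀ β q → ∃ λ m → β ≤ fromℚ (exponent q m)
exponent-unbounded β q with p , p∈U ← U-inhab β = m , λ s∈L → fromℚ-mono-≤ p≤r (U⇒≤fromℚ β p∈U s∈L)
  where
  n d m : ℕ
  n = ∣ ℚ.numerator p ∣
  d = ℚ.denominator-1 p
  m = n * suc q

  i≤∣i∣ : ∀ i → i ℤ.≤ + ∣ i ∣
  i≤∣i∣ (+ _)        = ℤ.≤-refl
  i≤∣i∣ (ℤ.-[1+ _ ]) = ℤ.-≤+

  n*Q≤ : n * suc q ℕ.≤ (suc q + suc m) * suc d
  n*Q≤ = begin
    n * suc q                   ≤⟨ ℕ.n≤1+n m ⟩
    suc m                       ≤⟨ ℕ.m≤n+m (suc m) (suc q) ⟩
    suc q + suc m               ≤⟨ ℕ.m≤m*n (suc q + suc m) (suc d) ⟩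
    (suc q + suc m) * suc d     ∎
    where open ℕ.≤-Reasoning

  p≤r : p ℚ.≤ exponent q m
  p≤r = subst (ℚ._≤ exponent q m) (ℚ.↥p/↧p≡p p)
    (/-mono {ℚ.numerator p} {+ (suc q + suc m)} {d} {q} (begin
      ℚ.numerator p ℤ.* + suc q        ≤⟨ ℤ.*-monoʳ-≤-nonNeg (+ suc q) (i≤∣i∣ (ℚ.numerator p)) ⟩
      + n ℤ.* + suc q                  ≡⟨ ℤ.pos-* n (suc q) ⟨
      + (n * suc q)                    ≤⟨ ℤ.+≤+ n*Q≤ ⟩
      + ((suc q + suc m) * suc d)      ≡⟨ ℤ.pos-* (suc q + suc m) (suc d) ⟩
      + (suc q + suc m) ℤ.* + suc d    ∎))
    where open ℤ.≤-Reasoning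

-- Finite factors of an infinite word

-- Factors are handled in reversed order, so that the letter read last is the head.

module _ {A : Set} where

  segment : (ℕ → A) → ℕ → ℕ → List A
  segment w i n = applyDownFrom (λ k → w (i + k)) n

  -- The length is a separate witness, so that matching the equation with `refl` turns `v` itself
  -- into a segment.
  _OccursIn_ : List A → (ℕ → A) → Set
  v OccursIn w = ∃₂ λ i n → v ≡ segment w i n

  -- Segments are stored backwards, which makes no difference for palindromes.
  occurs-palindrome⇒factor : ∀ {v} w → Palindrome v → v OccursIn w → v IsFactorOf w
  occurs-palindrome⇒factor {v} w pal (i , n , v≡) = i , (begin
    v                              ≡⟨ pal ⟩
    reverse v                      ≡⟨ cong reverse v≡ ⟩
    reverse (segment w i n)        ≡⟨ reverse-applyDownFrom f n ⟩
    applyUpTo f n                  ≡⟨ cong (applyUpTo f) (trans (cong length v≡) (length-applyDownFrom f n)) ⟨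
    applyUpTo f (length v)         ∎)
    where
    open ≡-Reasoning
    f = λ k → w (i + k)

  take-segment : ∀ w i l n → take l (segment w i n) OccursIn w
  take-segment w i l n = i + (n ∸ l) , l ℕ.⊓ n , go l n
    where
    go : ∀ l n → take l (segment w i n) ≡ segment w (i + (n ∸ l)) (l ℕ.⊓ n)
    go zero    n       = refl
    go (suc l) zero    = refl
    go (suc l) (suc n) = cong₂ _∷_ (cong w (sym eq)) (go l n)
      where
      eq : i + (n ∸ l) + (l ℕ.⊓ n) ≡ i + n
      eq = trans (ℕ.+-assoc i _ _) (cong (_+_ i) (trans (ℕ.+-comm (n ∸ l) _) (ℕ.m⊓n+n∸m≡n l n)))

  drop-segment : ∀ w i l n → drop l (segment w i n) ≡ segment w i (n ∸ l)
  drop-segment w i zero    n       = refl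
  drop-segment w i (suc l) zero    = refl
  drop-segment w i (suc l) (suc n) = drop-segment w i l n

-- Ternary words and plans of case distinctions

Word : Set
Word = List (Fin 3)

_≟_ : DecidableEquality Word
_≟_ = ≡-dec Fin._≟_

open import Data.List.Membership.DecPropositional _≟_ using (_∈?_)

does-sound : ∀ {P : Set} (p? : Dec P) → T (does p?) → P
does-sound (yes p) _ = p

does≡true : ∀ {P : Set} (p? : Dec P) → does p? ≡ true → P
does≡true p? eq = does-sound p? (from T-≡ eq)

-- Running out of letters counts as failure, so success also bounds both lengths from below.
agree : ℕ → Word → Word → Bool
agree zero    _        _        = true
agree (suc m) (x ∷ xs) (y ∷ ys) = does (x Fin.≟ y) ∧ agree m xs ys
agree (suc m) _        _        = false

agree-sound : ∀ w i m a b → T (agree m (segment w i a) (segment w i b)) →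
              ∃₂ λ a′ b′ → a ≡ m + a′ × b ≡ m + b′ ×
              (∀ {k} → k < m → w (i + (k + a′)) ≡ w (i + (k + b′)))
agree-sound w i zero    a       b       _  = a , b , refl , refl , λ ()
agree-sound w i (suc m) (suc a) (suc b) ok
  with head≡ , tail≡ ← to T-∧ ok
  with a′ , b′ , refl , refl , eqs ← agree-sound w i m a b tail≡
  = a′ , b′ , refl , refl , λ k<1+m →
    [ eqs , (λ { refl → does-sound (_ Fin.≟ _) head≡ }) ]′ (ℕ.m≤n⇒m<n∨m≡n (ℕ.s≤s⁻¹ k<1+m))

data Plan : Set where
  leaf  : Plan
  -- Either the word occurs (first subplan) or it is avoided (second subplan).
  split : Word → Plan → Plan → Plan

require exclude : List Word → Plan → Plan
require vs plan = foldr (λ v t → split v t leaf) plan vs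
exclude vs plan = foldr (λ v t → split v leaf t) plan vs

-- The backtracking search

-- An entry (q , m) of reps forbids the factors with period suc q and length suc q + suc m.
-- Only palindromes whose length is in lens are counted, and at most p of them are allowed.
module Search (p : ℕ) (reps : List (ℕ × ℕ)) (lens : List ℕ) where

  add : Word → List Word → List Word
  add v seen = if does (v ≟ reverse v) ∧ not (does (v ∈? seen)) then v ∷ seen else seen

  addPrefixes : Word → List Word → List Word
  addPrefixes xs seen = foldr (λ l → add (take l xs)) seen lens

  addFactors : Word → List Word → List Word
  addFactors []       seen = seen
  addFactors (x ∷ xs) seen = addPrefixes (x ∷ xs) (addFactors xs seen)

  repeats : ℕ × ℕ → Word → Bool
  repeats (q , m) xs = agree (suc m) xs (drop (suc q) xs)

  -- Only endings at the newest letter are tested, since appending a letter creates no other new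
  -- factors.
  dead : List Word → Word → Bool
  dead avoided xs = any (λ r → repeats r xs) reps ∨ any (λ v → does (v ≟ take (length v) xs)) avoided

  -- The value `true` certifies that `xs` cannot occur. Exhausted fuel gives `false`, which claims
  -- nothing, so the amount of fuel cannot affect soundness.
  search extend : ℕ → List Word → List Word → Word → Bool
  search zero       avoided seen xs = false
  search (suc fuel) avoided seen xs =
    (p <ᵇ length seen) ∨ all (λ c → extend fuel avoided seen (c ∷ xs)) (allFin 3)
  extend fuel avoided seen xs = dead avoided xs ∨ search fuel avoided (addPrefixes xs seen) xs

  run : Plan → List Word → List Word → Word → Bool
  run leaf          avoided seen xs = search 500 avoided seen xs
  run (split v t u) avoided seen xs =
    -- An occurrence of `v` may be far from `xs`, so the prefix restarts at `v`; the palindromes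
    -- already found are kept.
    run t avoided (addFactors v seen) v ∧ run u (v ∷ avoided) seen xs

  refuted : Plan → Bool
  -- The empty palindrome is counted from the start.
  refuted plan = run plan [] ([] ∷ []) []

  -- Soundness of the search

  module _ (w : ℕ → Fin 3)
           (no-repeat : All (λ (q , m) → ∀ j → ¬ RepeatsAt w j q m) reps)
           (few : w ContainsAtMost p Palindromes) where

    Seen : List Word → Set
    Seen vs = Unique vs × All (λ v → Palindrome v × v IsFactorOf w) vs

    Avoided : List Word → Set
    Avoided = All (λ v → ¬ v OccursIn w)

    add-seen : ∀ {v seen} → v OccursIn w → Seen seen → Seen (add v seen)
    add-seen {v} {seen} occ (uniq , pals) with v ≟ reverse v | v ∈? seen
    ... | yes pal | no v∉  = ¬Any⇒All¬ seen v∉ ∷ uniq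
                           , (pal , occurs-palindrome⇒factor w pal occ) ∷ pals
    ... | yes _   | yes _  = uniq , pals
    ... | no _    | _      = uniq , pals

    addPrefixes-seen : ∀ i n {seen} → Seen seen → Seen (addPrefixes (segment w i n) seen)
    addPrefixes-seen i n {seen} known = go lens
      where
      go : ∀ ls → Seen (foldr (λ l → add (take l (segment w i n))) seen ls)
      go []       = known
      go (l ∷ ls) = add-seen (take-segment w i l n) (go ls)

    addFactors-seen : ∀ i n {seen} → Seen seen → Seen (addFactors (segment w i n) seen)
    addFactors-seen i zero    known = known
    addFactors-seen i (suc n) known = addPrefixes-seen i (suc n) (addFactors-seen i n known)

    repeats-sound : ∀ i n q m → T (repeats (q , m) (segment w i n)) → ∃ λ j → RepeatsAt w j q m
    repeats-sound i n q m t
      with a , b , n≡ , n∸Q≡ , eqs ← agree-sound w i (suc m) n (n ∸ suc q)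
             (subst (T ∘ agree (suc m) (segment w i n)) (drop-segment w i (suc q) n) t)
      -- The older of the two agreeing blocks starts at `i + b`, the newer one a period later, at
      -- `i + a`.
      = i + b , λ {k} k<M → begin
        w (i + b + (k + suc q))    ≡⟨ cong w (ℕ.+-assoc i b (k + suc q)) ⟩
        w (i + (b + (k + suc q)))  ≡⟨ cong (λ z → w (i + z)) (shift k) ⟩
        w (i + (k + a))            ≡⟨ eqs k<M ⟩
        w (i + (k + b))            ≡⟨ cong (λ z → w (i + z)) (ℕ.+-comm k b) ⟩
        w (i + (b + k))            ≡⟨ cong w (ℕ.+-assoc i b k) ⟨
        w (i + b + k)              ∎
      where
      open ≡-Reasoning
      Q≤n : suc q ℕ.≤ n
      -- At least one letter agrees, so `n ∸ suc q` is nonzero and the subtraction is not truncated.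
      Q≤n = ℕ.<⇒≤ (ℕ.m∸n≢0⇒n<m λ n∸Q≡0 → case trans (sym n∸Q≡) n∸Q≡0 of λ ())
      a≡ : a ≡ b + suc q
      a≡ = ℕ.+-cancelˡ-≡ (suc m) a (b + suc q) (begin
        suc m + a            ≡⟨ n≡ ⟨
        n                    ≡⟨ ℕ.m∸n+n≡m Q≤n ⟨
        n ∸ suc q + suc q    ≡⟨ cong (_+ suc q) n∸Q≡ ⟩
        suc m + b + suc q    ≡⟨ ℕ.+-assoc (suc m) b (suc q) ⟩
        suc m + (b + suc q)  ∎)
      shift : ∀ k → b + (k + suc q) ≡ k + a
      shift k = begin
        b + (k + suc q)  ≡⟨ ℕ.+-assoc b k (suc q) ⟨
        b + k + suc q    ≡⟨ cong (_+ suc q) (ℕ.+-comm b k) ⟩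
        k + b + suc q    ≡⟨ ℕ.+-assoc k b (suc q) ⟩
        k + (b + suc q)  ≡⟨ cong (_+_ k) a≡ ⟨
        k + a            ∎

    dead-sound : ∀ {avoided} i n → Avoided avoided → ¬ T (dead avoided (segment w i n))
    dead-sound {avoided} i n av t = [ by-repeat , by-avoided ]′ (to T-∨ t)
      where
      by-repeat : ¬ T (any (λ r → repeats r (segment w i n)) reps)
      by-repeat t = All.lookupWith
        (λ { {q , m} ¬rep r → let j , rep = repeats-sound i n q m r in ¬rep j rep })
        no-repeat (any⁻ _ reps t)
      by-avoided : ¬ T (any (λ v → does (v ≟ take (length v) (segment w i n))) avoided)
      by-avoided t = All.lookupWith
        (λ {v} absent d → absent (subst (_OccursIn w) (sym (does-sound (_ ≟ _) d))
                                   (take-segment w i (length v) n)))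
        av (any⁻ _ avoided t)

    -- The segment is followed in `w` by the letter `w (i + n)`; among the refuted extensions is the
    -- one by this letter.
    search-sound : ∀ fuel {avoided seen} i n → Avoided avoided → Seen seen →
                   ¬ T (search fuel avoided seen (segment w i n))
    search-sound (suc fuel) {avoided} {seen} i n av known t with to T-∨ t
    ... | inj₁ many = ℕ.<⇒≱ (ℕ.<ᵇ⇒< p _ many) (few seen (proj₁ known) (proj₂ known))
    ... | inj₂ exts with to T-∨ $ All.lookup
            (all⁺ (λ c → extend fuel avoided seen (c ∷ segment w i n)) (allFin 3) exts)
            (∈-allFin (w (i + n)))
    ...   | inj₁ d = dead-sound i (suc n) av d
    ...   | inj₂ s = search-sound fuel i (suc n) av (addPrefixes-seen i (suc n) known) s

    -- The case split is constructive: refuting the first branch proves that `v` does not occur,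
    -- which is the assumption of the second.
    run-sound : ∀ plan {avoided seen} i n → Avoided avoided → Seen seen →
                ¬ T (run plan avoided seen (segment w i n))
    run-sound leaf          i n av known t = search-sound 500 i n av known t
    run-sound (split v s u) {avoided} {seen} i n av known t with s-ok , u-ok ← to (T-∧ {run s _ _ _}) t =
      run-sound u i n (absent ∷ av) known u-ok
      where
      absent : ¬ v OccursIn w
      absent (j , l , refl) = run-sound s j l av (addFactors-seen j l known) s-ok

    search⇒¬occurs : ∀ fuel v {seen} → Seen seen →
                     search fuel [] (addFactors v seen) v ≡ true → ¬ v OccursIn w
    search⇒¬occurs fuel v known eq (i , n , refl) =
      search-sound fuel i n [] (addFactors-seen i n known) (from T-≡ eq)

    []-seen : Seen ([] ∷ [])
    []-seen = [] ∷ [] , (refl , 0 , refl) ∷ []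

    refuted-sound : ∀ plan → refuted plan ≢ true
    refuted-sound plan eq = run-sound plan 0 0 [] []-seen (from T-≡ eq)

-- The four bounds

Long : ℚ → ℕ × ℕ → Set
Long b (q , m) = b ℚ.≤ exponent q m

long? : ∀ b reps → Dec (All (Long b) reps)
long? b = All.all? λ (q , m) → b ℚ.≤? exponent q m

-- For concrete data both Boolean equations are closed, so checking `refl` carries out the whole
-- search by evaluation.
no-infinite-word : ∀ {b p} reps lens plan →
                   does (long? b reps) ≡ true →
                   Search.refuted p reps lens plan ≡ true →
                   ¬ ∃ λ (w : ℕ → Fin 3) → w Is fromℚ b -Free × w ContainsAtMost p Palindromes
no-infinite-word {b} {p} reps lens plan long eq (w , free , few) =
  Search.refuted-sound p reps lens w
    (All.map
      (λ { {q , m} b≤e j rep → repeat⇒¬free w {j} {q} {m} rep {fromℚ b} (fromℚ-mono-≤ b≤e) free })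
      (does≡true (long? b reps) long))
    few plan eq

letters : List Word
letters = (0F ∷ []) ∷ (1F ∷ []) ∷ (2F ∷ []) ∷ []

permutations : List (Fin 3 × Fin 3 × Fin 3)
permutations = (0F , 1F , 2F) ∷ (1F , 2F , 0F) ∷ (2F , 0F , 1F) ∷
               (0F , 2F , 1F) ∷ (1F , 0F , 2F) ∷ (2F , 1F , 0F) ∷ []

-- In each entry (q , m) of the reps below, m is the least value for which the exponent reaches
-- the bound; the periods listed are those that the search runs into.
no-5-palindromes : ¬ ∃ λ (w : ℕ → Fin 3) → w Is fromℚ (+ 10 / 3) -Free × w ContainsAtMost 5 Palindromes
no-5-palindromes = no-infinite-word reps lens plan refl refl
  where
  reps = (0 , 2) ∷ (2 , 6) ∷ (3 , 9) ∷ (6 , 16) ∷ (10 , 25) ∷ (17 , 41) ∷ []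
  lens = 1 ∷ 2 ∷ 3 ∷ 4 ∷ 5 ∷ []
  -- The empty word and the letters use four of the five palindromes. At most one more may occur,
  -- and `00` and `11` are tried for it first.
  plan = require letters (exclude ((0F ∷ 0F ∷ []) ∷ (1F ∷ 1F ∷ []) ∷ []) leaf)

no-15-palindromes : ¬ ∃ λ (w : ℕ → Fin 3) → w Is fromℚ (+ 2 / 1) -Free × w ContainsAtMost 15 Palindromes
no-15-palindromes = no-infinite-word reps lens plan refl refl
  where
  reps = (0 , 0) ∷ (1 , 1) ∷ (2 , 2) ∷ (3 , 3) ∷ (5 , 5) ∷ (7 , 7) ∷ (10 , 10) ∷ (11 , 11) ∷ (12 , 12) ∷ []
  -- The entry `(0 , 0)` forbids equal adjacent letters, hence all nonempty palindromes of even
  -- length.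
  lens = 1 ∷ 3 ∷ 5 ∷ 7 ∷ 9 ∷ 11 ∷ 13 ∷ []
  plan = require letters (require ((0F ∷ 1F ∷ 0F ∷ []) ∷ []) leaf)

no-17-palindromes : ¬ ∃ λ (w : ℕ → Fin 3) → w Is fromℚ (+ 41 / 22) -Free × w ContainsAtMost 17 Palindromes
no-17-palindromes = no-infinite-word reps lens plan refl refl
  where
  reps = (0 , 0) ∷ (1 , 1) ∷ (2 , 2) ∷ (3 , 3) ∷ (5 , 5) ∷ (7 , 6) ∷ (10 , 9) ∷ (11 , 10) ∷
         (12 , 11) ∷ (14 , 12) ∷ (17 , 15) ∷ (21 , 18) ∷ (32 , 28) ∷ (35 , 31) ∷ (116 , 101) ∷ []
  lens = 1 ∷ 3 ∷ 5 ∷ 7 ∷ 9 ∷ 11 ∷ 13 ∷ []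
  -- Once all six words `abcba` occur, they make 16 palindromes together with the empty word, three
  -- letters and six words `bcb`. At most one more may occur, and the words `abcacba` are tried for
  -- it.
  plan = require letters
    (require (map (λ (a , b , c) → a ∷ b ∷ c ∷ b ∷ a ∷ []) permutations)
    (exclude (map (λ (a , b , c) → a ∷ b ∷ c ∷ a ∷ c ∷ b ∷ a ∷ []) permutations) leaf))

-- Since `β` is arbitrary, no particular repetition can be forbidden; only the palindrome count
-- acts.
module Four = Search 4 [] (1 ∷ 2 ∷ 3 ∷ 4 ∷ [])

-- A factor abcd with a ≢ d already contains five palindromes, counting the empty one.
FourLetters : Fin 3 → Fin 3 → Fin 3 → Fin 3 → Set
FourLetters a b c d = let v = d ∷ c ∷ b ∷ a ∷ [] in
  -- With fuel 1 and nothing forbidden, the search succeeds only by the count of palindromes in `v`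
  -- itself.
  d ≡ a ⊎ Four.search 1 [] (Four.addFactors v ([] ∷ [])) v ≡ true

four-letters? : Dec (∀ a b c d → FourLetters a b c d)
four-letters? = Fin.all? λ a → Fin.all? λ b → Fin.all? λ c → Fin.all? λ d →
  (d Fin.≟ a) ⊎-dec (_ Bool.≟ true)

four-letters : does four-letters? ≡ true
four-letters = refl

no-4-palindromes : ∀ (β : ℝ) → fromℚ 1ℚ ≤ β →
                   ¬ ∃ λ (w : ℕ → Fin 3) → w Is β -Free × w ContainsAtMost 4 Palindromes
no-4-palindromes β _ (w , free , few) with m , β≤e ← exponent-unbounded β 2 =
  -- The period is `suc 2`; full periodicity from position 0 supplies a repetition for any `m`.
  repeat⇒¬free w {0} {2} {m} (λ {k} _ → trans (cong w (ℕ.+-comm k 3)) (period-3 k)) {β} β≤e free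
  where
  period-3 : ∀ i → w (3 + i) ≡ w i
  -- With indices written as `i + k`, the four letters are definitionally those of `segment w i 4`.
  period-3 i = go (does≡true four-letters? four-letters (w (i + 0)) (w (i + 1)) (w (i + 2)) (w (i + 3)))
    where
    go : FourLetters (w (i + 0)) (w (i + 1)) (w (i + 2)) (w (i + 3)) → w (3 + i) ≡ w i
    go (inj₁ eq) = trans (cong w (ℕ.+-comm 3 i)) (trans eq (cong w (ℕ.+-identityʳ i)))
    go (inj₂ eq) = ⊥-elim (Four.search⇒¬occurs w [] few 1
                             (w (i + 3) ∷ w (i + 2) ∷ w (i + 1) ∷ w (i + 0) ∷ []) (Four.[]-seen w [] few) eq
                             (i , 4 , refl))

theorem1 : (∀ (β : ℝ) → fromℚ 1ℚ ≤ β →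
    ¬ ∃ λ (w : ℕ → Fin 3) → w Is β -Free × w ContainsAtMost 4 Palindromes) ×
    (¬ ∃ λ (w : ℕ → Fin 3) →
    w Is fromℚ (+ 10 / 3) -Free × w ContainsAtMost 5 Palindromes) ×
    (¬ ∃ λ (w : ℕ → Fin 3) →
    w Is fromℚ (+ 2 / 1) -Free × w ContainsAtMost 15 Palindromes) ×
    (¬ ∃ λ (w : ℕ → Fin 3) →
    w Is fromℚ (+ 41 / 22) -Free × w ContainsAtMost 17 Palindromes)
theorem1 = no-4-palindromes , no-5-palindromes , no-15-palindromes , no-17-palindromes
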